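{- Let $q$ be a prime power and $n,m,k$ positive integers with $n\le m$, and let $s=\max\{\lfloor n/2^{k-1}\rfloor,1\}$. Then $L_{\mathrm{rk}}(n,m,k,q)\le n-s+1$.
   Context: $\mathbb{F}_{q^m}$ is the degree-$m$ extension of $\mathbb{F}_q$. Rank weight of $\mathbf v=(v_1,\dots,v_n)\in\mathbb{F}_{q^m}^n$: $\mathrm{w}(\mathbf v)=\dim_{\mathbb{F}_q}\langle v_1,\dots,v_n\rangle_{\mathbb{F}_q}$. An $[n,k]_{q^m/q}$ code is a $k$-dimensional $\mathbb{F}_{q^m}$-subspace $\mathcal C\subseteq\mathbb{F}_{q^m}^n$ with weight spectrum $\mathrm{WS}(\mathcal C)=\{\mathrm{w}(\mathbf c):\mathbf c\in\mathcal C\setminus\{\mathbf 0\}\}$. $L_{\mathrm{rk}}(n,m,k,q)$ is the maximum of $|\mathrm{WS}(\mathcal C)|$ over all $[n,k]_{q^m/q}$ codes $\mathcal C$. -}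

module Defs where

open import Level using (Level; _⊔_)
open import Data.Nat as ℕ using (ℕ; zero; suc; _^_; _∸_; _/_)
open import Data.Nat.Properties using (m^n≢0)
open import Data.Nat.Primality using (Prime)
open import Data.Fin using (Fin; zero; suc)
open import Data.Product using (Σ; ∃; _×_; _,_)
open import Relation.Binary.PropositionalEquality using (_≡_)
open import Relation.Nullary using (¬_)
open import Algebra.Bundles using (CommutativeRing)
open import Algebra.Morphism.Structures using (IsRingHomomorphism)

record Field (c ℓ : Level) : Set (Level.suc (c ⊔ ℓ)) where
  field
    commutativeRing : CommutativeRing c ℓ
  open CommutativeRing commutativeRing public
  field
    0≉1     : ¬ (0# ≈ 1#)
    inverse : ∀ x → ¬ (x ≈ 0#) → ∃ λ y → (x * y) ≈ 1#

IsPrimePower : ℕ → Set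
IsPrimePower q = Σ ℕ λ p → Σ ℕ λ r → Prime p × (1 ℕ.≤ r) × (q ≡ p ^ r)

sParam : ℕ → ℕ → ℕ
sParam n k = (_/_ n (2 ^ (k ∸ 1)) {{m^n≢0 2 (k ∸ 1)}}) ℕ.⊔ 1

module _ {c ℓ : Level} (K : Field c ℓ) where
  open Field K using (Carrier; _≈_; _+_; 0#)

  Σ[_] : (d : ℕ) → (Fin d → Carrier) → Carrier
  Σ[ zero ] f = 0#
  Σ[ suc d ] f = f zero + Σ[ d ] (λ i → f (suc i))

  HasCardinality : ℕ → Set (c ⊔ ℓ)
  HasCardinality q = Σ (Fin q → Carrier) λ e →
    (∀ i j → e i ≈ e j → i ≡ j) × (∀ x → ∃ λ i → e i ≈ x)

-- Setting: F a field (the base field F_q), L a field (F_{q^m}),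
-- ι : F → L a ring homomorphism (the field embedding F ⊆ L).
module Ext {c₁ ℓ₁ c₂ ℓ₂ : Level} (F : Field c₁ ℓ₁) (L : Field c₂ ℓ₂)
           (ι : Field.Carrier F → Field.Carrier L) where
  private
    module F = Field F
    module L = Field L
  open L using (Carrier; _≈_; _*_; 0#)

  combF : ∀ {d} → (Fin d → F.Carrier) → (Fin d → Carrier) → Carrier
  combF {d} a u = Σ[ L ] d (λ i → ι (a i) * u i)

  IndepF : ∀ {d} → (Fin d → Carrier) → Set (c₁ ⊔ ℓ₁ ⊔ ℓ₂)
  IndepF {d} u = ∀ (a : Fin d → F.Carrier) → combF a u ≈ 0# → ∀ i → a i F.≈ F.0#

  InSpanF : ∀ {d} → (Fin d → Carrier) → Carrier → Set (c₁ ⊔ ℓ₂)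
  InSpanF {d} u x = ∃ λ (a : Fin d → F.Carrier) → x ≈ combF a u

  HasDegree : ℕ → Set (c₁ ⊔ ℓ₁ ⊔ c₂ ⊔ ℓ₂)
  HasDegree m = Σ (Fin m → Carrier) λ b → IndepF b × (∀ x → InSpanF b x)

  DimSpanF : ∀ {n} → (Fin n → Carrier) → ℕ → Set (c₁ ⊔ ℓ₁ ⊔ c₂ ⊔ ℓ₂)
  DimSpanF {n} v d = Σ (Fin d → Carrier) λ b →
    IndepF b × (∀ i → InSpanF v (b i)) × (∀ j → InSpanF b (v j))

  RankWeight : ∀ {n} → (Fin n → Carrier) → ℕ → Set (c₁ ⊔ ℓ₁ ⊔ c₂ ⊔ ℓ₂)
  RankWeight = DimSpanF

  IndepRowsL : ∀ {k n} → (Fin k → Fin n → Carrier) → Set (c₂ ⊔ ℓ₂)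
  IndepRowsL {k} {n} G = ∀ (x : Fin k → Carrier) →
    (∀ j → Σ[ L ] k (λ i → x i * G i j) ≈ 0#) → ∀ i → x i ≈ 0#

  -- An [n,k]_{q^m/q} code C is given by a generator matrix G (k × n, rows L-independent);
  -- its codewords are x G for x ∈ L^k.
  codeword : ∀ {k n} → (Fin k → Fin n → Carrier) → (Fin k → Carrier) → Fin n → Carrier
  codeword {k} G x j = Σ[ L ] k (λ i → x i * G i j)

  NonZeroVec : ∀ {n} → (Fin n → Carrier) → Set ℓ₂
  NonZeroVec v = ¬ (∀ j → v j ≈ 0#)

  InWS : ∀ {k n} → (Fin k → Fin n → Carrier) → ℕ → Set (c₁ ⊔ ℓ₁ ⊔ c₂ ⊔ ℓ₂)
  InWS G d = ∃ λ x → NonZeroVec (codeword G x) × RankWeight (codeword G x) d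

{-# OPTIONS --safe #-}
-- Run through the weights w of C in increasing order, each with a codeword, and
-- keep an independent family of r codewords whose weights sum to M.  Every word in
-- their span has weight at most M, so either w ≤ M or the codeword of w can be added
-- to the family, which replaces M by M + w.  In the second case at least
-- w - M - 1 values were skipped; if g counts all skipped values, then
-- M + w ≤ 2M + 1 + (w - M - 1) yields M + 1 ≤ 2^(r-1) (2 + g) throughout.  As r ≤ k,
-- this forces g plus the number n - M of values above M to be at least s - 1.
module Submission where

open import Defs
open import Level using (Level; _⊔_)
open import Data.Nat using (ℕ; zero; suc; _≤_; _<_; _∸_; _+_; _*_; _^_; z≤n; s≤s; s≤s⁻¹)
open import Data.Nat.Properties using (≤-decTotalOrder)
open import Data.Nat.DivMod using (m<n*o⇒m/o<n)
open import Data.Nat.Tactic.RingSolver using (solve-∀)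
open import Data.List using (List; []; _∷_; length)
open import Data.List.Relation.Unary.All as All using (All; []; _∷_)
open import Data.List.Relation.Unary.AllPairs as AllPairs using (AllPairs; []; _∷_)
open import Data.List.Relation.Unary.Linked.Properties using (Linked⇒AllPairs)
open import Data.List.Relation.Unary.Unique.Propositional using (Unique)
open import Data.List.Relation.Binary.Permutation.Propositional using (↭-sym; ↭⇒↭ₛ)
open import Data.List.Relation.Binary.Permutation.Propositional.Properties using (All-resp-↭; ↭-length)
import Data.List.Relation.Binary.Permutation.Setoid.Properties as Permutationₛ
open import Data.List.Sort ≤-decTotalOrder using (sort; sort-↭; sort-↗)
open import Data.Fin using (Fin; zero; suc; punchIn; punchOut; _↑ˡ_; _↑ʳ_)
import Data.Fin.Properties as Fin
open import Data.Product using (Σ; _×_; _,_; proj₁; proj₂)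
open import Data.Sum using (_⊎_; inj₁; inj₂)
import Data.Vec.Functional as Vec
open import Data.Vec.Functional.Properties using (lookup-++ˡ; lookup-++ʳ)
open import Function using (_∘_)
open import Relation.Nullary using (¬_; Dec; yes; no; contradiction; ¬?)
open import Relation.Nullary.Decidable using (decidable-stable)
open import Relation.Binary.PropositionalEquality as ≡ using (_≡_)
import Relation.Binary.Reasoning.Setoid as SetoidReasoning
import Algebra.Properties.Ring as RingProperties
import Algebra.Properties.Semiring.Sum as SemiringSum
import Algebra.Properties.CommutativeSemigroup as CommutativeSemigroupProperties
open import Algebra.Morphism.Structures using (IsRingHomomorphism)

-- Finite sums over a field.

module FieldSum {c ℓ : Level} (K : Field c ℓ) where
  open Field K hiding (zero) renaming (_+_ to _⊕_; _*_ to _⊛_)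
  open SemiringSum semiring using (sum; ∑-distrib-+; *-distribˡ-sum; *-distribʳ-sum)

  Σ≡sum : ∀ d (f : Fin d → Carrier) → Σ[ K ] d f ≡ sum f
  Σ≡sum zero    f = ≡.refl
  Σ≡sum (suc d) f = ≡.cong (f zero ⊕_) (Σ≡sum d (f ∘ suc))

  Σ-cong : ∀ d {f g : Fin d → Carrier} → (∀ i → f i ≈ g i) → Σ[ K ] d f ≈ Σ[ K ] d g
  Σ-cong zero    f≈g = refl
  Σ-cong (suc d) f≈g = +-cong (f≈g zero) (Σ-cong d (f≈g ∘ suc))

  Σ-zero : ∀ d {f : Fin d → Carrier} → (∀ i → f i ≈ 0#) → Σ[ K ] d f ≈ 0#
  Σ-zero zero    f≈0 = refl
  Σ-zero (suc d) f≈0 = trans (+-cong (f≈0 zero) (Σ-zero d (f≈0 ∘ suc))) (+-identityˡ 0#)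

  Σ-distrib-+ : ∀ d (f g : Fin d → Carrier) →
    Σ[ K ] d (λ i → f i ⊕ g i) ≈ Σ[ K ] d f ⊕ Σ[ K ] d g
  Σ-distrib-+ d f g
    rewrite Σ≡sum d (λ i → f i ⊕ g i) | Σ≡sum d f | Σ≡sum d g = ∑-distrib-+ f g

  *-distribˡ-Σ : ∀ d x (f : Fin d → Carrier) → x ⊛ Σ[ K ] d f ≈ Σ[ K ] d (λ i → x ⊛ f i)
  *-distribˡ-Σ d x f rewrite Σ≡sum d (λ i → x ⊛ f i) | Σ≡sum d f = *-distribˡ-sum x f

  *-distribʳ-Σ : ∀ d x (f : Fin d → Carrier) → Σ[ K ] d f ⊛ x ≈ Σ[ K ] d (λ i → f i ⊛ x)
  *-distribʳ-Σ d x f rewrite Σ≡sum d (λ i → f i ⊛ x) | Σ≡sum d f = *-distribʳ-sum x f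

  Σ-comm : ∀ d e (f : Fin d → Fin e → Carrier) →
    Σ[ K ] d (λ i → Σ[ K ] e (f i)) ≈ Σ[ K ] e (λ j → Σ[ K ] d (λ i → f i j))
  Σ-comm zero    e f = sym (Σ-zero e (λ _ → refl))
  Σ-comm (suc d) e f = trans (+-congˡ (Σ-comm d e (f ∘ suc))) (sym (Σ-distrib-+ e (f zero) _))

  -- Interchange of two finite sums. It serves transitivity of spans over F and the passage from
  -- relations among messages to relations among codewords.
  Σ-*-assoc : ∀ d e (a : Fin d → Carrier) (B : Fin d → Fin e → Carrier) (u : Fin e → Carrier) →
    Σ[ K ] e (λ j → Σ[ K ] d (λ i → a i ⊛ B i j) ⊛ u j) ≈
    Σ[ K ] d (λ i → a i ⊛ Σ[ K ] e (λ j → B i j ⊛ u j))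
  Σ-*-assoc d e a B u = begin
    Σ[ K ] e (λ j → Σ[ K ] d (λ i → a i ⊛ B i j) ⊛ u j)
      ≈⟨ Σ-cong e (λ j → *-distribʳ-Σ d (u j) _) ⟩
    Σ[ K ] e (λ j → Σ[ K ] d (λ i → a i ⊛ B i j ⊛ u j))
      ≈⟨ Σ-comm e d _ ⟩
    Σ[ K ] d (λ i → Σ[ K ] e (λ j → a i ⊛ B i j ⊛ u j))
      ≈⟨ Σ-cong d (λ i → Σ-cong e (λ j → *-assoc _ _ _)) ⟩
    Σ[ K ] d (λ i → Σ[ K ] e (λ j → a i ⊛ (B i j ⊛ u j)))
      ≈⟨ Σ-cong d (λ i → *-distribˡ-Σ e (a i) _) ⟨
    Σ[ K ] d (λ i → a i ⊛ Σ[ K ] e (λ j → B i j ⊛ u j)) ∎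
    where open SetoidReasoning setoid

  Σ-split : ∀ d e (f : Fin (d + e) → Carrier) →
    Σ[ K ] (d + e) f ≈ Σ[ K ] d (λ i → f (i ↑ˡ e)) ⊕ Σ[ K ] e (λ j → f (d ↑ʳ j))
  Σ-split zero    e f = sym (+-identityˡ _)
  Σ-split (suc d) e f = trans (+-congˡ (Σ-split d e (f ∘ suc))) (sym (+-assoc _ _ _))

-- Linear independence and Gaussian elimination.

module IndependentRows {c ℓ : Level} (K : Field c ℓ)
                       (≈0? : ∀ x → Dec (Field._≈_ K x (Field.0# K))) where
  open Field K hiding (zero) renaming (_+_ to _⊕_; _*_ to _⊛_; -_ to ⊖_)
  open FieldSum K
  open RingProperties ring using (-‿distribˡ-*)

  Independent : ∀ {r k} → (Fin r → Fin k → Carrier) → Set (c ⊔ ℓ)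
  Independent = Ext.IndepRowsL K K (λ x → x)

  -- Gaussian elimination: a nonzero entry of row 0 is the pivot, and its column is dropped.
  independent⇒≤ : ∀ {r k} (A : Fin r → Fin k → Carrier) → Independent A → r ≤ k
  independent⇒≤ {zero}  A ind = z≤n
  independent⇒≤ {suc r} A ind with Fin.any? (λ j → ¬? (≈0? (A zero j)))
  -- A zero row 0 would make the coefficients (1, 0, ..., 0) a nontrivial relation.
  ... | no ¬pivot = contradiction (sym (ind e₀ e₀A≈0 zero)) 0≉1
    where
    e₀ : Fin (suc r) → Carrier
    e₀ zero    = 1#
    e₀ (suc _) = 0#

    row₀≈0 : ∀ j → A zero j ≈ 0#
    row₀≈0 j = decidable-stable (≈0? (A zero j)) (λ A₀ⱼ≉0 → ¬pivot (j , A₀ⱼ≉0))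

    e₀A≈0 : ∀ j → Σ[ K ] (suc r) (λ i → e₀ i ⊛ A i j) ≈ 0#
    e₀A≈0 j = Σ-zero (suc r) {λ i → e₀ i ⊛ A i j}
      λ { zero → trans (*-identityˡ _) (row₀≈0 j) ; (suc i) → zeroˡ _ }
  independent⇒≤ {suc r} {zero}   A ind | yes (() , _)
  independent⇒≤ {suc r} {suc k′} A ind | yes (j , A₀ⱼ≉0) =
    s≤s (independent⇒≤ (λ i l → reduced i (punchIn j l)) reduced-ind)
    where
    open SetoidReasoning setoid

    y = proj₁ (inverse (A zero j) A₀ⱼ≉0)

    reduced : Fin r → Fin (suc k′) → Carrier
    reduced i l = A (suc i) l ⊕ A (suc i) j ⊛ (⊖ y ⊛ A zero l)

    reduced-pivot : ∀ i → reduced i j ≈ 0#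
    reduced-pivot i = begin
      x ⊕ x ⊛ (⊖ y ⊛ A zero j)     ≈⟨ +-congʳ (*-identityʳ x) ⟨
      x ⊛ 1# ⊕ x ⊛ (⊖ y ⊛ A zero j) ≈⟨ distribˡ x 1# _ ⟨
      x ⊛ (1# ⊕ ⊖ y ⊛ A zero j)    ≈⟨ *-congˡ (+-congˡ (-‿distribˡ-* y _)) ⟨
      x ⊛ (1# ⊕ ⊖ (y ⊛ A zero j))  ≈⟨ *-congˡ (+-congˡ (-‿cong (trans (*-comm _ _) (proj₂ (inverse (A zero j) A₀ⱼ≉0))))) ⟩
      x ⊛ (1# ⊕ ⊖ 1#)              ≈⟨ *-congˡ (-‿inverseʳ 1#) ⟩
      x ⊛ 0#                       ≈⟨ zeroʳ x ⟩
      0# ∎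
      where x = A (suc i) j

    reduced-ind : Independent (λ i l → reduced i (punchIn j l))
    reduced-ind a a-reduced≈0 i = ind a′ a′A≈0 (suc i)
      where
      a′ : Fin (suc r) → Carrier
      -- The total coefficient that row 0 receives when the reduced rows are expanded.
      a′ zero    = Σ[ K ] r (λ i → a i ⊛ A (suc i) j) ⊛ ⊖ y
      a′ (suc i) = a i

      combine : ∀ l → Σ[ K ] (suc r) (λ i → a′ i ⊛ A i l) ≈ Σ[ K ] r (λ i → a i ⊛ reduced i l)
      combine l = begin
        S ⊛ ⊖ y ⊛ A zero l ⊕ T                                ≈⟨ +-comm _ T ⟩
        T ⊕ S ⊛ ⊖ y ⊛ A zero l                                ≈⟨ +-congˡ (*-assoc S _ _) ⟩
        T ⊕ S ⊛ z                                             ≈⟨ +-congˡ (*-distribʳ-Σ r z _) ⟩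
        T ⊕ Σ[ K ] r (λ i → a i ⊛ A (suc i) j ⊛ z)            ≈⟨ Σ-distrib-+ r _ _ ⟨
        Σ[ K ] r (λ i → a i ⊛ A (suc i) l ⊕ a i ⊛ A (suc i) j ⊛ z)
          ≈⟨ Σ-cong r (λ i → trans (+-congˡ (*-assoc _ _ _)) (sym (distribˡ (a i) _ _))) ⟩
        Σ[ K ] r (λ i → a i ⊛ reduced i l) ∎
        where
        z = ⊖ y ⊛ A zero l
        S = Σ[ K ] r (λ i → a i ⊛ A (suc i) j)
        T = Σ[ K ] r (λ i → a i ⊛ A (suc i) l)

      a′A≈0 : ∀ l → Σ[ K ] (suc r) (λ i → a′ i ⊛ A i l) ≈ 0#
      -- The dropped column `j` is not covered by `a-reduced≈0`, but the elimination made it zero.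
      a′A≈0 l with j Fin.≟ l
      ... | yes ≡.refl = trans (combine j) (Σ-zero r (λ i → trans (*-congˡ (reduced-pivot i)) (zeroʳ _)))
      ... | no j≢l = ≡.subst (λ l → Σ[ K ] (suc r) (λ i → a′ i ⊛ A i l) ≈ 0#)
                       (Fin.punchIn-punchOut j≢l) (trans (combine _) (a-reduced≈0 (punchOut j≢l)))

-- Decidable equality in a finite field.

module _ {c ℓ : Level} (K : Field c ℓ) where
  open Field K using (_≈_; sym; trans)

  hasCardinality⇒≈-dec : ∀ {q} → HasCardinality K q → ∀ x y → Dec (x ≈ y)
  hasCardinality⇒≈-dec (e , e-inj , e-surj) x y with e-surj x | e-surj y
  ... | i , eᵢ≈x | j , eⱼ≈y with i Fin.≟ j
  ...   | yes ≡.refl = yes (trans (sym eᵢ≈x) eⱼ≈y)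
  ...   | no i≢j     = no λ x≈y → i≢j (e-inj i j (trans eᵢ≈x (trans x≈y (sym eⱼ≈y))))

-- Spans over the base field and bounds on rank weight.

module Extension {c₁ ℓ₁ c₂ ℓ₂ : Level} (F : Field c₁ ℓ₁) (L : Field c₂ ℓ₂)
                 (ι : Field.Carrier F → Field.Carrier L)
                 (ι-hom : IsRingHomomorphism (Field.rawRing F) (Field.rawRing L) ι)
                 (F-≈0? : ∀ x → Dec (Field._≈_ F x (Field.0# F))) where
  private module F = Field F
  open Field L hiding (zero) renaming (_+_ to _⊕_; _*_ to _⊛_; -_ to ⊖_)
  open Ext F L ι
  open FieldSum L
  open IsRingHomomorphism ι-hom using (⟦⟧-cong; 0#-homo; +-homo; *-homo)
  open CommutativeSemigroupProperties *-commutativeSemigroup using (x∙yz≈y∙xz)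
  open SetoidReasoning setoid

  ι-Σ : ∀ d (f : Fin d → F.Carrier) → ι (Σ[ F ] d f) ≈ Σ[ L ] d (ι ∘ f)
  ι-Σ zero    f = 0#-homo
  ι-Σ (suc d) f = trans (+-homo _ _) (+-congˡ (ι-Σ d (f ∘ suc)))

  combF-zero : ∀ {d} {a : Fin d → F.Carrier} (u : Fin d → Carrier) →
    (∀ i → a i F.≈ F.0#) → combF a u ≈ 0#
  combF-zero {d} u a≈0 =
    Σ-zero d (λ i → trans (*-congʳ (trans (⟦⟧-cong (a≈0 i)) 0#-homo)) (zeroˡ _))

  combF-combF : ∀ {d e} (a : Fin d → F.Carrier) (B : Fin d → Fin e → F.Carrier) (u : Fin e → Carrier) →
    combF a (λ i → combF (B i) u) ≈ combF (λ j → Σ[ F ] d (λ i → a i F.* B i j)) u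
  combF-combF {d} {e} a B u = sym (begin
    combF (λ j → Σ[ F ] d (λ i → a i F.* B i j)) u
      ≈⟨ Σ-cong e (λ j → *-congʳ (trans (ι-Σ d _) (Σ-cong d (λ i → *-homo _ _)))) ⟩
    Σ[ L ] e (λ j → Σ[ L ] d (λ i → ι (a i) ⊛ ι (B i j)) ⊛ u j)
      ≈⟨ Σ-*-assoc d e _ _ u ⟩
    combF a (λ i → combF (B i) u) ∎)

  combF-congʳ : ∀ {d} (a : Fin d → F.Carrier) {u v : Fin d → Carrier} →
    (∀ i → u i ≈ v i) → combF a u ≈ combF a v
  combF-congʳ {d} a u≈v = Σ-cong d (λ i → *-congˡ (u≈v i))

  InSpanF-trans : ∀ {d e} {v : Fin d → Carrier} {u : Fin e → Carrier} →
    (∀ i → InSpanF u (v i)) → ∀ {x} → InSpanF v x → InSpanF u x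
  InSpanF-trans {u = u} v∈u (a , x≈av) =
    _ , trans x≈av (trans (combF-congʳ a (proj₂ ∘ v∈u)) (combF-combF a (proj₁ ∘ v∈u) u))

  -- Steinitz bound: a relation among the coefficient rows of `b` over `u` is a relation among the
  -- `b i`, so these rows are independent and elimination over F applies.
  indepF⇒≤ : ∀ {d e} {b : Fin d → Carrier} {u : Fin e → Carrier} →
    IndepF b → (∀ i → InSpanF u (b i)) → d ≤ e
  indepF⇒≤ {u = u} b-ind b∈u =
    IndependentRows.independent⇒≤ F F-≈0? (proj₁ ∘ b∈u) λ a aB≈0 →
      b-ind a (trans (combF-congʳ a (proj₂ ∘ b∈u))
                (trans (combF-combF a (proj₁ ∘ b∈u) u) (combF-zero u aB≈0)))

  -- An element of L vanishes exactly when all its coordinates in the basis `b` do, and those are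
  -- tested in F.
  hasDegree⇒≈0-dec : ∀ {m} → HasDegree m → ∀ x → Dec (x ≈ 0#)
  hasDegree⇒≈0-dec (b , b-ind , b-span) x with b-span x
  ... | a , x≈ab with Fin.all? (λ i → F-≈0? (a i))
  ...   | yes a≈0 = yes (trans x≈ab (combF-zero b a≈0))
  ...   | no  a≉0 = no λ x≈0 → a≉0 (b-ind a (trans (sym x≈ab) x≈0))

  -- Expresses rank weight at most `M`. The generators may be dependent and may lie outside the span
  -- of `v`, so bounds scale and add without a choice of bases.
  SpannedBy : ∀ {n} → ℕ → (Fin n → Carrier) → Set (c₁ ⊔ c₂ ⊔ ℓ₂)
  SpannedBy M v = Σ (Fin M → Carrier) λ u → ∀ j → InSpanF u (v j)

  spannedBy-resp-≈ : ∀ {n M} {v w : Fin n → Carrier} → (∀ j → v j ≈ w j) → SpannedBy M v → SpannedBy M w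
  spannedBy-resp-≈ v≈w (u , v∈u) =
    u , λ j → proj₁ (v∈u j) , trans (sym (v≈w j)) (proj₂ (v∈u j))

  spannedBy-scale : ∀ {n M} x {v : Fin n → Carrier} → SpannedBy M v → SpannedBy M (λ j → x ⊛ v j)
  spannedBy-scale {M = M} x (u , v∈u) = (λ i → x ⊛ u i) , λ j → let a , v≈au = v∈u j in
    a , trans (*-congˡ v≈au) (trans (*-distribˡ-Σ M x _) (Σ-cong M (λ i → x∙yz≈y∙xz x _ _)))

  -- Subadditivity of rank weight, by concatenating the two generating families.
  spannedBy-+ : ∀ {n M N} {v w : Fin n → Carrier} → SpannedBy M v → SpannedBy N w →
    SpannedBy (M + N) (λ j → v j ⊕ w j)
  spannedBy-+ {M = M} {N} {v} {w} (u , v∈u) (t , w∈t) = u Vec.++ t , v+w∈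
    where
    v+w∈ : ∀ j → InSpanF (u Vec.++ t) (v j ⊕ w j)
    v+w∈ j with v∈u j | w∈t j
    ... | a , v≈au | b , w≈bt = a Vec.++ b , (begin
      v j ⊕ w j          ≈⟨ +-cong v≈au w≈bt ⟩
      combF a u ⊕ combF b t
        ≈⟨ +-cong
             (Σ-cong M (λ i → reflexive (≡.cong₂ (λ x y → ι x ⊛ y) (lookup-++ˡ a b i) (lookup-++ˡ u t i))))
             (Σ-cong N (λ i → reflexive (≡.cong₂ (λ x y → ι x ⊛ y) (lookup-++ʳ a b i) (lookup-++ʳ u t i)))) ⟨
      Σ[ L ] M (λ i → ι ((a Vec.++ b) (i ↑ˡ N)) ⊛ (u Vec.++ t) (i ↑ˡ N)) ⊕
      Σ[ L ] N (λ i → ι ((a Vec.++ b) (M ↑ʳ i)) ⊛ (u Vec.++ t) (M ↑ʳ i))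
        ≈⟨ Σ-split M N _ ⟨
      combF (a Vec.++ b) (u Vec.++ t) ∎)

  rankWeight≤spannedBy : ∀ {n d M} {v : Fin n → Carrier} → RankWeight v d → SpannedBy M v → d ≤ M
  rankWeight≤spannedBy (b , b-ind , b∈v , _) (u , v∈u) =
    indepF⇒≤ b-ind (λ i → InSpanF-trans v∈u (b∈v i))

  -- Independent families of codewords with bounded weight.

  module Code {k n : ℕ} (G : Fin k → Fin n → Carrier) (≈0? : ∀ x → Dec (x ≈ 0#)) where

    inWS⇒≤n : ∀ {w} → InWS G w → w ≤ n
    inWS⇒≤n (_ , _ , _ , b-ind , b∈v , _) = indepF⇒≤ b-ind b∈v

    inWS⇒>0 : ∀ {w} → InWS G w → 0 < w
    -- An empty basis makes every coordinate an empty sum, so the codeword would be zero.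
    inWS⇒>0 {zero}  (_ , v≉0 , _ , _ , _ , v∈b) = contradiction (proj₂ ∘ v∈b) v≉0
    inWS⇒>0 {suc _} _ = s≤s z≤n

    -- Independence is imposed on the messages `X i`, which have `k` entries; this is what yields
    -- `r ≤ k`.
    Subcode : ℕ → ℕ → Set (c₁ ⊔ c₂ ⊔ ℓ₂)
    Subcode r M = Σ (Fin r → Fin k → Carrier) λ X → IndepRowsL X ×
      (∀ a → SpannedBy M (codeword (λ i → codeword G (X i)) a))

    subcode-zero : Subcode 0 0
    subcode-zero = (λ ()) , (λ _ _ ()) , λ _ → (λ ()) , λ _ → (λ ()) , refl

    subcode⇒≤k : ∀ {r M} → Subcode r M → r ≤ k
    subcode⇒≤k (X , X-ind , _) = IndependentRows.independent⇒≤ L ≈0? X X-ind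

    -- Which alternative holds depends on whether `x` lies in the span of `X`, which is not decided
    -- here; hence the double negation. If neither alternative held, `x` could not depend on `X`, as
    -- that would give `w ≤ M`, so the extended family would be independent.
    subcode-extend : ∀ {r M w} → Subcode r M → InWS G w → ¬ ¬ (w ≤ M ⊎ Subcode (suc r) (w + M))
    subcode-extend {r} {M} {w} (X , X-ind , X-span) (x , _ , rank@(b , _ , _ , v∈b)) ¬goal =
      ¬goal (inj₂ (X′ , X′-ind , X′-span))
      where
      X′ : Fin (suc r) → Fin k → Carrier
      X′ = x Vec.∷ X

      X′-span : ∀ a → SpannedBy (w + M) (codeword (λ i → codeword G (X′ i)) a)
      X′-span a = spannedBy-+ (spannedBy-scale (a zero) (b , v∈b)) (X-span (a ∘ suc))

      X′-ind : IndepRowsL X′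
      X′-ind a aX′≈0 with ≈0? (a zero)
      ... | yes a₀≈0 = λ { zero → a₀≈0 ; (suc i) → X-ind (a ∘ suc) aX≈0 i }
        where
        aX≈0 : ∀ l → Σ[ L ] r (λ i → a (suc i) ⊛ X i l) ≈ 0#
        aX≈0 l = begin
          T                    ≈⟨ +-identityˡ T ⟨
          0# ⊕ T               ≈⟨ +-congʳ (trans (*-congʳ a₀≈0) (zeroˡ _)) ⟨
          a zero ⊛ x l ⊕ T     ≈⟨ aX′≈0 l ⟩
          0# ∎
          where T = Σ[ L ] r (λ i → a (suc i) ⊛ X i l)
      -- Solving the relation for `x` puts its codeword in the span of the family, where weights are
      -- at most `M`.
      ... | no a₀≉0 = contradiction (inj₁ (rankWeight≤spannedBy rank
                        (spannedBy-resp-≈ (sym ∘ v≈) (spannedBy-scale (⊖ y) (X-span (a ∘ suc)))))) ¬goal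
        where
        open RingProperties ring using (-‿distribˡ-*; -‿distribʳ-*; +-inverseˡ-unique)
        y = proj₁ (inverse (a zero) a₀≉0)

        v≈ : ∀ j → codeword G x j ≈ ⊖ y ⊛ codeword (λ i → codeword G (X i)) (a ∘ suc) j
        v≈ j = begin
          v                   ≈⟨ *-identityˡ v ⟨
          1# ⊛ v              ≈⟨ *-congʳ (trans (*-comm y _) (proj₂ (inverse (a zero) a₀≉0))) ⟨
          y ⊛ a zero ⊛ v      ≈⟨ *-assoc y _ v ⟩
          y ⊛ (a zero ⊛ v)    ≈⟨ *-congˡ (+-inverseˡ-unique _ S a₀v+S≈0) ⟩
          y ⊛ ⊖ S             ≈⟨ -‿distribʳ-* y S ⟨
          ⊖ (y ⊛ S)           ≈⟨ -‿distribˡ-* y S ⟩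
          ⊖ y ⊛ S ∎
          where
          v = codeword G x j
          S = codeword (λ i → codeword G (X i)) (a ∘ suc) j

          a₀v+S≈0 : a zero ⊛ v ⊕ S ≈ 0#
          -- (aX′)G = a(X′G), and aX′ vanishes.
          a₀v+S≈0 = trans (sym (Σ-*-assoc (suc r) k a X′ (λ l → G l j)))
            (Σ-zero k (λ l → trans (*-congʳ (aX′≈0 l)) (zeroˡ _)))

-- Counting weights, with arithmetic on natural numbers only.

module WeightCount {a b : Level} (n k : ℕ) (1≤k : 1 ≤ k)
  (Subcode : ℕ → ℕ → Set a) (Weight : ℕ → Set b)
  (subcode⇒≤k : ∀ {r M} → Subcode r M → r ≤ k)
  (weight⇒≤n : ∀ {w} → Weight w → w ≤ n)
  (extend : ∀ {r M w} → Subcode r M → Weight w → ¬ ¬ (w ≤ M ⊎ Subcode (suc r) (w + M))) where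

  open import Data.Nat.Properties hiding (≤-decTotalOrder)
  open ≤-Reasoning

  -- The factor 2 on the left of the growth bound replaces the exponent `r - 1`, which would fail at
  -- `r = 0`.
  sParam≤ : ∀ {r M g} → r ≤ k → 2 * (1 + M) ≤ 2 ^ r * (2 + g) → sParam n k ≤ 1 + g + (n ∸ M)
  sParam≤ {r} {M} {g} r≤k growth = go k 1≤k r≤k
    where
    go : ∀ k → 1 ≤ k → r ≤ k → sParam n k ≤ 1 + g + (n ∸ M)
    -- Matching on `k` lets `k ∸ 1` compute to `k′`; the strict bound on the quotient then loses
    -- one.
    go (suc k′) _ r≤k = ⊔-lub (s≤s⁻¹ (m<n*o⇒m/o<n n<)) (s≤s z≤n)
      where
      P = 2 ^ k′
      instance P≢0 = m^n≢0 2 k′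

      M< : M < (2 + g) * P
      M< = *-cancelˡ-≤ 2 (begin
        2 * (1 + M)         ≤⟨ growth ⟩
        2 ^ r * (2 + g)     ≤⟨ *-monoˡ-≤ (2 + g) (^-monoʳ-≤ 2 r≤k) ⟩
        2 * P * (2 + g)     ≡⟨ *-assoc 2 P (2 + g) ⟩
        2 * (P * (2 + g))   ≡⟨ ≡.cong (2 *_) (*-comm P (2 + g)) ⟩
        2 * ((2 + g) * P)   ∎)

      n< : n < (2 + g + (n ∸ M)) * P
      n< = begin-strict
        n                             ≤⟨ m≤n+m∸n n M ⟩
        M + (n ∸ M)                   <⟨ +-mono-<-≤ M< (m≤m*n (n ∸ M) P) ⟩
        (2 + g) * P + (n ∸ M) * P     ≡⟨ *-distribʳ-+ P (2 + g) (n ∸ M) ⟨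
        (2 + g + (n ∸ M)) * P         ∎

  -- Up to `n`, the `c` weights and `g` skipped values fit below or at `M`, and `n ∸ M` values lie
  -- above it; together they number at most `n`.
  count≤-final : ∀ {M g c s} → c + g ≤ M → c + g ≤ n → s ≤ 1 + g + (n ∸ M) → c ≤ n ∸ s + 1
  count≤-final {M} {g} {c} {s} c+g≤M c+g≤n s≤ = +-cancelʳ-≤ s c _ (begin
    c + s                   ≤⟨ +-monoʳ-≤ c s≤ ⟩
    c + (1 + g + (n ∸ M))   ≡⟨ shuffle c g (n ∸ M) ⟩
    1 + (c + g + (n ∸ M))   ≤⟨ s≤s within ⟩
    1 + n                   ≤⟨ s≤s (m≤n+m∸n n s) ⟩
    1 + (s + (n ∸ s))       ≡⟨ shuffle′ s (n ∸ s) ⟩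
    n ∸ s + 1 + s           ∎)
    where
    shuffle : ∀ c g t → c + (1 + g + t) ≡ 1 + (c + g + t)
    shuffle = solve-∀
    shuffle′ : ∀ s t → 1 + (s + t) ≡ t + 1 + s
    shuffle′ = solve-∀

    within : c + g + (n ∸ M) ≤ n
    within with ≤-total M n
    ... | inj₁ M≤n = ≤-trans (+-monoˡ-≤ (n ∸ M) c+g≤M) (≤-reflexive (m+[n∸m]≡n M≤n))
    ... | inj₂ n≤M = begin
      c + g + (n ∸ M)  ≡⟨ ≡.cong (c + g +_) (m≤n⇒m∸n≡0 n≤M) ⟩
      c + g + 0        ≡⟨ +-identityʳ _ ⟩
      c + g            ≤⟨ c+g≤n ⟩
      n                ∎

  -- With e = `w ∸ suc M`, truncation gives w ≤ M + 1 + e in every case, so 1 + w + M ≤ 2(1 + M) +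
  -- e. The remaining 2e is absorbed because 2 ≤ 2^(r+1).
  growth-step : ∀ {r M g} w → 2 * (1 + M) ≤ 2 ^ r * (2 + g) →
    2 * (1 + (w + M)) ≤ 2 ^ suc r * (2 + (g + (w ∸ suc M)))
  growth-step {r} {M} {g} w growth = begin
    2 * (1 + (w + M))                ≤⟨ *-monoʳ-≤ 2 (s≤s (+-monoˡ-≤ M (m≤n+m∸n w (suc M)))) ⟩
    2 * (1 + (suc M + e + M))        ≡⟨ double M e ⟩
    2 * (2 * (1 + M)) + 2 * e        ≤⟨ +-mono-≤ (*-monoʳ-≤ 2 growth) (*-monoˡ-≤ e 2≤) ⟩
    2 * (2 ^ r * (2 + g)) + 2 ^ suc r * e  ≡⟨ collect (2 ^ r) g e ⟩
    2 ^ suc r * (2 + (g + e))        ∎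
    where
    e = w ∸ suc M
    2≤ : 2 ≤ 2 ^ suc r
    2≤ = ^-monoʳ-≤ 2 {1} {suc r} (s≤s z≤n)
    double : ∀ M e → 2 * (1 + (suc M + e + M)) ≡ 2 * (2 * (1 + M)) + 2 * e
    double = solve-∀
    collect : ∀ p g e → 2 * (p * (2 + g)) + 2 * p * e ≡ 2 * p * (2 + (g + e))
    collect = solve-∀

  -- If `w` exceeds `M`, the values strictly between them are the new skipped ones, on top of the c
  -- + g ≤ M old values. Otherwise nothing is added to `g` and `ℓ < w` makes room for `w` itself.
  skipped-step : ∀ {c g ℓ M w} → c + g ≤ ℓ → c + g ≤ M → ℓ < w → suc c + (g + (w ∸ suc M)) ≤ w
  skipped-step {c} {g} {ℓ} {M} {w} c+g≤ℓ c+g≤M ℓ<w with ≤-total (suc M) w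
  ... | inj₁ M<w = begin
    suc c + (g + (w ∸ suc M))  ≡⟨ +-assoc (suc c) g _ ⟨
    suc (c + g) + (w ∸ suc M)  ≤⟨ +-monoˡ-≤ _ (s≤s c+g≤M) ⟩
    suc M + (w ∸ suc M)        ≡⟨ m+[n∸m]≡n M<w ⟩
    w                          ∎
  ... | inj₂ w≤1+M = begin
    suc c + (g + (w ∸ suc M))  ≡⟨ ≡.cong (λ e → suc c + (g + e)) (m≤n⇒m∸n≡0 w≤1+M) ⟩
    suc c + (g + 0)            ≡⟨ ≡.cong (suc c +_) (+-identityʳ g) ⟩
    suc (c + g)                ≤⟨ s≤s c+g≤ℓ ⟩
    suc ℓ                      ≤⟨ ℓ<w ⟩
    w                          ∎

  -- c weights have been processed, ℓ is the last of them, and g counts the values skipped.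
  count≤-from : ∀ {r M c g ℓ} → Subcode r M → c + g ≤ ℓ → c + g ≤ M → ℓ ≤ n →
    2 * (1 + M) ≤ 2 ^ r * (2 + g) →
    ∀ {ws} → AllPairs _<_ ws → All (ℓ <_) ws → All Weight ws → c + length ws ≤ n ∸ sParam n k + 1
  count≤-from {c = c} C c+g≤ℓ c+g≤M ℓ≤n growth [] [] []
    rewrite +-identityʳ c =
    count≤-final c+g≤M (≤-trans c+g≤ℓ ℓ≤n) (sParam≤ (subcode⇒≤k C) growth)
  count≤-from {r} {M} {c} {g} {ℓ} C c+g≤ℓ c+g≤M ℓ≤n growth
    {w ∷ ws} (w<ws ∷ sorted) (ℓ<w ∷ _) (weight ∷ weights) =
    -- The goal is a decidable inequality, so the doubly negated alternative may be used.
    decidable-stable (_ ≤? _) λ ¬goal → extend C weight λ case →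
      ¬goal (≤-trans (≤-reflexive (+-suc c (length ws))) (step case))
    where
    step : w ≤ M ⊎ Subcode (suc r) (w + M) → suc c + length ws ≤ n ∸ sParam n k + 1
    -- Only the count grows; `w ≤ M` keeps it below `M`.
    step (inj₁ w≤M) = count≤-from C 1+c+g≤w (≤-trans 1+c+g≤w w≤M) (weight⇒≤n weight)
      growth sorted w<ws weights
      where
      1+c+g≤w : suc c + g ≤ w
      1+c+g≤w = ≤-trans (s≤s c+g≤ℓ) ℓ<w
    step (inj₂ C′) = count≤-from C′ ≤w (≤-trans ≤w (m≤m+n w M)) (weight⇒≤n weight)
      (growth-step {r} w growth) sorted w<ws weights
      where
      ≤w : suc c + (g + (w ∸ suc M)) ≤ w
      ≤w = skipped-step {c} {g} c+g≤ℓ c+g≤M ℓ<w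

  count≤ : Subcode 0 0 → (∀ {w} → Weight w → 0 < w) →
    ∀ {ws} → Unique ws → All Weight ws → length ws ≤ n ∸ sParam n k + 1
  count≤ C₀ weight⇒>0 {ws} unique weights =
    ≡.subst (_≤ n ∸ sParam n k + 1) (↭-length (sort-↭ ws))
      -- The start is the empty family with all counters 0, where the growth bound reads 2 ≤ 2.
      -- Sorting and distinctness give a strictly increasing list.
      (count≤-from C₀ z≤n z≤n z≤n ≤-refl
        (AllPairs.zipWith (λ (x≤y , x≢y) → ≤∧≢⇒< x≤y x≢y)
          (Linked⇒AllPairs ≤-trans (sort-↗ ws) ,
           Permutationₛ.Unique-resp-↭ (≡.setoid ℕ) (↭⇒↭ₛ sorted↭) unique))
        (All.map weight⇒>0 sorted-weights) sorted-weights)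
    where
    sorted↭ = ↭-sym (sort-↭ ws)
    sorted-weights = All-resp-↭ sorted↭ weights

theorem3p9 : ∀ {c₁ ℓ₁ c₂ ℓ₂ : Level} (q n m k : ℕ) → IsPrimePower q →
    1 ≤ n → 1 ≤ m → 1 ≤ k → n ≤ m →
    (F : Field c₁ ℓ₁) → HasCardinality F q →
    (L : Field c₂ ℓ₂) → (ι : Field.Carrier F → Field.Carrier L) →
    IsRingHomomorphism (Field.rawRing F) (Field.rawRing L) ι →
    Ext.HasDegree F L ι m →
    (G : Fin k → Fin n → Field.Carrier L) → Ext.IndepRowsL F L ι G →
    (ws : List ℕ) → Unique ws → All (Ext.InWS F L ι G) ws →
    length ws ≤ n ∸ sParam n k + 1
theorem3p9 q n m k _ _ _ 1≤k _ F F-card L ι ι-hom L-degree G _ ws unique weights =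
  WeightCount.count≤ n k 1≤k C.Subcode (Ext.InWS F L ι G) C.subcode⇒≤k C.inWS⇒≤n C.subcode-extend
    C.subcode-zero C.inWS⇒>0 unique weights
  where
  module E = Extension F L ι ι-hom (λ x → hasCardinality⇒≈-dec F F-card x (Field.0# F))
  module C = E.Code G (E.hasDegree⇒≈0-dec L-degree)
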